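{- Let $n\ge 2$, let $P\neq[n,n-1,\ldots,1]$ be an arithmetically progressed permutation of length $n$ with ratio $k$, and let $\mathsf{T}_P$ be its associated ternary string. Then the matrix-based BWT of $\mathsf{T}_P$ coincides with the suffix-array-based BWT of $\mathsf{T}_P$.
   Context: Alphabet $\{\mathtt{a}<\mathtt{b}<\mathtt{c}\}$, lexicographic order $\prec$ with a proper prefix smaller than the longer string; suffix array $\mathsf{SA}_{\mathsf{T}}$: permutation of $[1..n]$ such that $\mathsf{T}[\mathsf{SA}_{\mathsf{T}}[i]..n]$ is the $i$-th smallest suffix. $x\bmod n$ denotes the representative of $x$ modulo $n$ in $[1..n]$. An arithmetically progressed permutation of length $n$ with ratio $k\in[1..n-1]$ is a permutation $P=[p_1,\ldots,p_n]$ of $[1..n]$ with $p_{i+1}=p_i+k\bmod n$. Ternary string associated with $P$: cut $P$ immediately after the entry $n-k$ and immediately after the entry $(p_1-k-1)\bmod n$, giving consecutive possibly empty blocks $A,B,C$ with $P=ABC$; set $\mathsf{T}_P[p_i]=\mathtt{a},\mathtt{b},\mathtt{c}$ according as $p_i$ lies in $A$, $B$, $C$. Suffix-array-based BWT: $\mathsf{BWT}_{\mathsf{T}}[i]=\mathsf{T}[\mathsf{SA}_{\mathsf{T}}[i]-1\bmod n]$. Matrix-based BWT: sort the $n$ cyclic rotations $\mathsf{T}[j..n]\mathsf{T}[1..j-1]$ lexicographically and read, top to bottom, the last character of each sorted rotation. -}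

module Defs where

open import Data.Bool.Base using (if_then_else_)
open import Data.Fin.Base as Fin using (Fin; toℕ; fromℕ<)
open import Data.Fin.Patterns using (0F; 1F; 2F)
open import Data.Fin.Permutation using (Permutation′; _⟨$⟩ʳ_; _⟨$⟩ˡ_)
import Data.Fin.Properties as Fin
open import Data.Integer.Base as ℤ using (ℤ; +_; _%ℕ_)
open import Data.Integer.DivMod using (n%ℕd<d)
open import Data.List.Base as List using (List; drop; take; _++_; allFin; last; mapMaybe)
import Data.List.Relation.Binary.Lex.NonStrict as Lex
import Data.List.Sort as Sort
open import Data.Nat.Base using (ℕ; suc; NonZero; _<_; _≤_; _⊓_; _⊔_; _≤ᵇ_)
open import Data.Vec.Base using (Vec; lookup; tabulate; toList)
open import Level using (0ℓ)
open import Relation.Binary.Bundles using (DecTotalOrder)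
import Relation.Binary.Construct.On as On
open import Relation.Binary.PropositionalEquality.Core using (_≡_)

private variable
  n : ℕ

-- The range [1..n], of positions as well as of entries of permutations, is
-- represented by Fin n: the element i stands for the number val i = toℕ i + 1.
-- All arithmetic below is on these one-based values.

val : Fin n → ℤ
val i = + suc (toℕ i)

-- The representative of x modulo n in [1..n] (so 0 mod₁ n stands for n).

_mod₁_ : ℤ → (n : ℕ) → .{{_ : NonZero n}} → Fin n
x mod₁ n = fromℕ< (n%ℕd<d (x ℤ.- + 1) n)

infixl 5 _mod₁_

------------------------------------------------------------------------
-- Strings over {a < b < c}

Letter : Set
Letter = Fin 3

pattern a = 0F
pattern b = 1F
pattern c = 2F

String : ℕ → Set
String n = Vec Letter n

lexOrder : DecTotalOrder 0ℓ 0ℓ 0ℓ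
lexOrder = Lex.≤-decTotalOrder (Fin.≤-decTotalOrder 3)

-- T[j..n]
suffix : String n → Fin n → List Letter
suffix T j = drop (toℕ j) (toList T)

-- T[j..n] T[1..j-1]
rotation : String n → Fin n → List Letter
rotation T j = suffix T j ++ take (toℕ j) (toList T)

-- Distinct positions have distinct suffixes, so the sorted list is unique.
suffixArray : String n → List (Fin n)
suffixArray {n} T = Sort.sort (On.decTotalOrder lexOrder (suffix T)) (allFin n)

saBWT : .{{_ : NonZero n}} → String n → List Letter
saBWT {n} T = List.map (λ j → lookup T (val j ℤ.- + 1 mod₁ n)) (suffixArray T)

-- Each rotation has length n. If n is positive then every rotation has a last
-- character, so mapMaybe discards nothing.
matrixBWT : String n → List Letter
matrixBWT {n} T = mapMaybe last (Sort.sort lexOrder (List.map (rotation T) (allFin n)))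

------------------------------------------------------------------------
-- Arithmetically progressed permutations

-- P = [p₁,…,pₙ] is given as a bijection, with P ⟨$⟩ʳ i the entry at index i and
-- P ⟨$⟩ˡ p the index of the entry p.

record ArithmeticallyProgressed .{{_ : NonZero n}} (P : Permutation′ n) (k : ℕ) : Set where
  field
    1≤k  : 1 ≤ k
    k<n  : k < n
    step : ∀ (i j : Fin n) → toℕ j ≡ suc (toℕ i) →
           P ⟨$⟩ʳ j ≡ (val (P ⟨$⟩ʳ i) ℤ.+ + k mod₁ n)

-- The blocks of P = ABC are determined by the indices of the two entries after
-- which P is cut: A consists of the entries whose index is at most the smaller
-- of these, B of the remaining ones whose index is at most the larger, and C of
-- the rest. Thus A is never empty, B is empty if the two cuts coincide, and C
-- is empty if one of them is at the end of P.

module _ .{{_ : NonZero n}} (P : Permutation′ n) (k : ℕ) where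

  p₁ : Fin n
  p₁ = P ⟨$⟩ʳ (+ 1 mod₁ n)

  cut₁ cut₂ : Fin n
  cut₁ = P ⟨$⟩ˡ (+ n ℤ.- + k mod₁ n)
  cut₂ = P ⟨$⟩ˡ (val p₁ ℤ.- + k ℤ.- + 1 mod₁ n)

  blockLetter : Fin n → Letter
  blockLetter i =
    if toℕ i ≤ᵇ toℕ cut₁ ⊓ toℕ cut₂ then a else
    if toℕ i ≤ᵇ toℕ cut₁ ⊔ toℕ cut₂ then b else c

  ternaryString : String n
  ternaryString = tabulate (λ p → blockLetter (P ⟨$⟩ˡ p))

{-# OPTIONS --safe #-}

-- Write κ p = p + k and σ p = p + 1 (cyclically). If p is not the last entry of
-- P, then κ p follows p in P, so T[p] ≤ T[κ p], and the inequality is strict if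
-- P is cut after p. The last entry of P is p₁ − k, so the cut after p₁ − k − 1
-- ensures that reading T[p], T[σ p], … against T[κ p], T[σ (κ p)], … meets a
-- strict inequality before reaching the last entry of P. Likewise, the cut after
-- n − k ensures that it does so before the second string passes position n.
-- Hence both the suffixes and the rotations are non-decreasing along P, and
-- both transforms read T[p − 1] for p along P.

module Submission where

open import Defs
open import Data.Bool.Base using (true; false; if_then_else_)
open import Data.Fin.Base as Fin using (Fin; zero; suc; toℕ; fromℕ<)
import Data.Fin.Properties as Fin
open import Data.Fin.Permutation using (Permutation′; reverse; _≈_; _⟨$⟩ʳ_; _⟨$⟩ˡ_; inverseˡ; inverseʳ)
open import Data.Integer.Base as ℤ using (ℤ; +_; _%ℕ_; _/ℕ_; 0ℤ; 1ℤ)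
open import Data.Integer.DivMod using (n%ℕd<d; a≡a%ℕn+[a/ℕn]*n)
import Data.Integer.Properties as ℤ
open import Data.Integer.Tactic.RingSolver using (solve-∀)
open import Data.List.Base as List using (List; []; _∷_; _++_; drop; take; allFin; last; mapMaybe; length)
open import Data.List.Properties using (length-drop; mapMaybe-map; mapMaybe-cong; mapMaybe-just; ++-identityʳ)
open import Data.List.Membership.Propositional using (_∈_)
open import Data.List.Membership.Propositional.Properties using (∈-tabulate⁺; ∈-allFin)
open import Data.List.Membership.Propositional.Properties.WithK using (unique∧set⇒bag)
open import Data.List.Relation.Binary.BagAndSetEquality using (∼bag⇒↭)
open import Data.List.Relation.Binary.Lex.NonStrict using (halt; this; next; base)
open import Data.List.Relation.Binary.Permutation.Propositional using (_↭_; ↭-trans; ↭⇒↭ₛ)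
import Data.List.Relation.Binary.Permutation.Homogeneous as Homogeneous
open import Data.List.Relation.Binary.Permutation.Propositional.Properties using (map⁺)
open import Data.List.Relation.Binary.Pointwise as Pointwise using (Pointwise; Pointwise-length; Pointwise-≡⇒≡)
open import Data.List.Relation.Unary.Linked as Linked using (Linked; []; [-]; _∷_)
import Data.List.Relation.Unary.Linked.Properties as Linked
import Data.List.Relation.Unary.Sorted.TotalOrder as Sorted
open import Data.List.Relation.Unary.Sorted.TotalOrder.Properties using (↗↭↗⇒≋)
open import Data.List.Relation.Unary.Unique.Propositional.Properties using (tabulate⁺; allFin⁺)
import Data.List.Sort as Sort
open import Data.Maybe.Base using (just)
open import Data.Nat.Base as ℕ using (ℕ; zero; suc; NonZero; z≤n; s≤s; _+_; _∸_; _⊓_; _⊔_; _≤_; _<_; _≤ᵇ_)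
open import Data.Nat.Divisibility using (divides; n∣m⇒m%n≡0)
open import Data.Nat.DivMod using (m<n⇒m%n≡m)
import Data.Nat.Properties as ℕ
open import Data.Product.Base using (∃-syntax; _,_)
open import Data.Sum.Base using (_⊎_; inj₁; inj₂)
open import Data.Unit.Base using (tt)
open import Data.Vec.Base using (lookup; toList; _∷_; [])
open import Data.Vec.Properties using (lookup∘tabulate; length-toList)
open import Function.Base using (_∘_)
open import Function.Bundles using (mk⇔)
open import Level using (Level)
open import Relation.Binary.Bundles using (DecTotalOrder)
import Relation.Binary.Construct.On as On
open import Relation.Binary.Core using (Rel)
open import Relation.Binary.PropositionalEquality
open import Relation.Nullary.Decidable using (yes; no)
open import Relation.Nullary.Negation.Core using (¬_; contradiction)
open import Relation.Nullary.Reflects using (ofʸ; ofⁿ)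

private variable
  ℓ ℓ₁ ℓ₂ ℓ₃ : Level
  A : Set ℓ
  n : ℕ

-- Residues modulo n

-- The distance between two numbers below n is itself below n, so it equals its own remainder modulo
-- n; being a multiple of n, it is 0.
remainder-unique : ∀ {r s} q → r < n → s < n → + r ≡ + s ℤ.+ q ℤ.* + n → r ≡ s
remainder-unique {n = suc m} {r} {s} q r<n s<n eq = ℤ.+-injective (ℤ.i-j≡0⇒i≡j (+ r) (+ s) (ℤ.∣i∣≡0⇒i≡0 (begin
  d             ≡⟨ m<n⇒m%n≡m d<n ⟨
  d ℕ.% n′      ≡⟨ n∣m⇒m%n≡0 d n′ (divides ℤ.∣ q ∣ d≡∣q∣n) ⟩
  0             ∎)))
  where
  open ≡-Reasoning
  n′ = suc m
  d = ℤ.∣ + r ℤ.- + s ∣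
  d<n : d < n′
  d<n = ℕ.≤-<-trans
    (subst (λ z → ℤ.∣ z ∣ ≤ r ⊔ s) (sym (ℤ.m-n≡m⊖n r s)) (ℤ.∣m⊝n∣≤m⊔n r s))
    (ℕ.⊔-lub r<n s<n)
  cancel : ∀ x y → x ℤ.+ y ℤ.- x ≡ y
  cancel = solve-∀
  d≡∣q∣n : d ≡ ℤ.∣ q ∣ ℕ.* n′
  d≡∣q∣n = begin
    ℤ.∣ + r ℤ.- + s ∣                      ≡⟨ cong (λ z → ℤ.∣ z ℤ.- + s ∣) eq ⟩
    ℤ.∣ + s ℤ.+ q ℤ.* + n′ ℤ.- + s ∣       ≡⟨ cong ℤ.∣_∣ (cancel (+ s) (q ℤ.* + n′)) ⟩
    ℤ.∣ q ℤ.* + n′ ∣                       ≡⟨ ℤ.abs-* q (+ n′) ⟩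
    ℤ.∣ q ∣ ℕ.* n′                         ∎

module _ .{{_ : NonZero n}} where

  -- Together with `mod₁-unique` this is the interface to `mod₁`: congruences become integer
  -- identities with an explicit quotient.
  mod₁-decompose : ∀ x → ∃[ q ] x ≡ val (x mod₁ n) ℤ.+ q ℤ.* + n
  mod₁-decompose x = (x ℤ.- + 1) /ℕ n , (begin
    x                                         ≡⟨ shift x ⟩
    + 1 ℤ.+ (x ℤ.- + 1)                       ≡⟨ cong (λ z → + 1 ℤ.+ z) (a≡a%ℕn+[a/ℕn]*n (x ℤ.- + 1) n) ⟩
    + 1 ℤ.+ (+ r ℤ.+ q ℤ.* + n)               ≡⟨ ℤ.+-assoc (+ 1) (+ r) (q ℤ.* + n) ⟨
    + suc r ℤ.+ q ℤ.* + n                     ≡⟨ cong (λ z → + suc z ℤ.+ q ℤ.* + n) (Fin.toℕ-fromℕ< (n%ℕd<d (x ℤ.- + 1) n)) ⟨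
    val (x mod₁ n) ℤ.+ q ℤ.* + n              ∎)
    where
    open ≡-Reasoning
    q = (x ℤ.- + 1) /ℕ n
    r = (x ℤ.- + 1) %ℕ n
    shift : ∀ x → x ≡ + 1 ℤ.+ (x ℤ.- + 1)
    shift = solve-∀

  mod₁-unique : ∀ {x} (i : Fin n) q → x ≡ val i ℤ.+ q ℤ.* + n → x mod₁ n ≡ i
  mod₁-unique {x} i q eq with mod₁-decompose x
  ... | q′ , eq′ = Fin.toℕ-injective (remainder-unique (q ℤ.- q′) (Fin.toℕ<n _) (Fin.toℕ<n i) (begin
    + toℕ j                                                       ≡⟨ isolate (+ toℕ j) q′ (+ n) ⟩
    + 1 ℤ.+ + toℕ j ℤ.+ q′ ℤ.* + n ℤ.- + 1 ℤ.- q′ ℤ.* + n         ≡⟨ cong (λ z → z ℤ.- + 1 ℤ.- q′ ℤ.* + n) (trans (sym eq′) eq) ⟩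
    + 1 ℤ.+ + toℕ i ℤ.+ q ℤ.* + n ℤ.- + 1 ℤ.- q′ ℤ.* + n          ≡⟨ collect (+ toℕ i) q q′ (+ n) ⟩
    + toℕ i ℤ.+ (q ℤ.- q′) ℤ.* + n                                ∎))
    where
    open ≡-Reasoning
    j = x mod₁ n
    isolate : ∀ a q n → a ≡ + 1 ℤ.+ a ℤ.+ q ℤ.* n ℤ.- + 1 ℤ.- q ℤ.* n
    isolate = solve-∀
    collect : ∀ a q q′ n → + 1 ℤ.+ a ℤ.+ q ℤ.* n ℤ.- + 1 ℤ.- q′ ℤ.* n ≡ a ℤ.+ (q ℤ.- q′) ℤ.* n
    collect = solve-∀

  infixl 6 _⊕_

  -- The offset is an integer, so forward and backward cyclic shifts have one form; `p ⊕ + k` and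
  -- `p ⊕ ℤ.- + 1` unfold to the terms found in `step` and `saBWT`.
  _⊕_ : Fin n → ℤ → Fin n
  i ⊕ x = val i ℤ.+ x mod₁ n

  mod₁-⊕ : ∀ x y → (x mod₁ n) ⊕ y ≡ (x ℤ.+ y mod₁ n)
  mod₁-⊕ x y with mod₁-decompose x | mod₁-decompose (val (x mod₁ n) ℤ.+ y)
  ... | q , eq | q′ , eq′ = sym (mod₁-unique ((x mod₁ n) ⊕ y) (q ℤ.+ q′) (begin
    x ℤ.+ y                                                   ≡⟨ cong (ℤ._+ y) eq ⟩
    v ℤ.+ q ℤ.* + n ℤ.+ y                                     ≡⟨ swap v q (+ n) y ⟩
    v ℤ.+ y ℤ.+ q ℤ.* + n                                     ≡⟨ cong (ℤ._+ q ℤ.* + n) eq′ ⟩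
    val ((x mod₁ n) ⊕ y) ℤ.+ q′ ℤ.* + n ℤ.+ q ℤ.* + n         ≡⟨ collect (val ((x mod₁ n) ⊕ y)) q q′ (+ n) ⟩
    val ((x mod₁ n) ⊕ y) ℤ.+ (q ℤ.+ q′) ℤ.* + n               ∎))
    where
    open ≡-Reasoning
    v = val (x mod₁ n)
    swap : ∀ v q n y → v ℤ.+ q ℤ.* n ℤ.+ y ≡ v ℤ.+ y ℤ.+ q ℤ.* n
    swap = solve-∀
    collect : ∀ w q q′ n → w ℤ.+ q′ ℤ.* n ℤ.+ q ℤ.* n ≡ w ℤ.+ (q ℤ.+ q′) ℤ.* n
    collect = solve-∀

  ⊕-assoc : ∀ i x y → i ⊕ x ⊕ y ≡ i ⊕ (x ℤ.+ y)
  ⊕-assoc i x y = trans (mod₁-⊕ (val i ℤ.+ x) y) (cong (_mod₁ n) (ℤ.+-assoc (val i) x y))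

  ⊕-comm : ∀ i x y → i ⊕ x ⊕ y ≡ i ⊕ y ⊕ x
  ⊕-comm i x y = trans (⊕-assoc i x y) (trans (cong (i ⊕_) (ℤ.+-comm x y)) (sym (⊕-assoc i y x)))

  ⊕-identityʳ : ∀ i → i ⊕ 0ℤ ≡ i
  ⊕-identityʳ i = mod₁-unique i 0ℤ refl

  ⊕-inverseʳ : ∀ i x → i ⊕ x ⊕ (ℤ.- x) ≡ i
  ⊕-inverseʳ i x = trans (⊕-assoc i x (ℤ.- x)) (trans (cong (i ⊕_) (ℤ.+-inverseʳ x)) (⊕-identityʳ i))

  ⊕-cancelʳ : ∀ {i j} x → i ⊕ x ≡ j ⊕ x → i ≡ j
  ⊕-cancelʳ {i} {j} x eq = trans (sym (⊕-inverseʳ i x)) (trans (cong (_⊕ (ℤ.- x)) eq) (⊕-inverseʳ j x))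

  ⊕-periodic : ∀ i x → i ⊕ (x ℤ.+ + n) ≡ i ⊕ x
  ⊕-periodic i x with mod₁-decompose (val i ℤ.+ x)
  ... | q , eq = mod₁-unique (i ⊕ x) (q ℤ.+ 1ℤ) (begin
    val i ℤ.+ (x ℤ.+ + n)                       ≡⟨ ℤ.+-assoc (val i) x (+ n) ⟨
    val i ℤ.+ x ℤ.+ + n                         ≡⟨ cong (ℤ._+ + n) eq ⟩
    val (i ⊕ x) ℤ.+ q ℤ.* + n ℤ.+ + n           ≡⟨ collect (val (i ⊕ x)) q (+ n) ⟩
    val (i ⊕ x) ℤ.+ (q ℤ.+ 1ℤ) ℤ.* + n          ∎)
    where
    open ≡-Reasoning
    collect : ∀ w q n → w ℤ.+ q ℤ.* n ℤ.+ n ≡ w ℤ.+ (q ℤ.+ 1ℤ) ℤ.* n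
    collect = solve-∀

  -- Spelled as in `p₁`, so that `P ⟨$⟩ʳ first` is `p₁ P k` by unfolding.
  first : Fin n
  first = + 1 mod₁ n

  toℕ-first : toℕ first ≡ 0
  toℕ-first = trans
    (cong toℕ (mod₁-unique (fromℕ< (ℕ.>-nonZero⁻¹ n)) 0ℤ
      (cong (λ z → + suc z ℤ.+ 0ℤ) (sym (Fin.toℕ-fromℕ< (ℕ.>-nonZero⁻¹ n))))))
    (Fin.toℕ-fromℕ< (ℕ.>-nonZero⁻¹ n))

  toℕ-⊕1 : ∀ i → suc (toℕ i) < n → toℕ (i ⊕ + 1) ≡ suc (toℕ i)
  toℕ-⊕1 i i+1<n = trans (cong toℕ (mod₁-unique (fromℕ< i+1<n) 0ℤ eq)) (Fin.toℕ-fromℕ< i+1<n)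
    where
    open ≡-Reasoning
    eq : val i ℤ.+ + 1 ≡ val (fromℕ< i+1<n) ℤ.+ 0ℤ
    eq = begin
      + (suc (toℕ i) + 1)                     ≡⟨ cong (λ z → + z) (ℕ.+-comm (suc (toℕ i)) 1) ⟩
      + suc (suc (toℕ i))                     ≡⟨ cong (λ z → + suc z) (Fin.toℕ-fromℕ< i+1<n) ⟨
      val (fromℕ< i+1<n)                      ≡⟨ ℤ.+-identityʳ _ ⟨
      val (fromℕ< i+1<n) ℤ.+ 0ℤ               ∎

  ⊕1-wraps : ∀ i → suc (toℕ i) ≡ n → i ⊕ + 1 ≡ first
  ⊕1-wraps i i+1≡n = mod₁-unique first 1ℤ (begin
    + suc (toℕ i) ℤ.+ + 1             ≡⟨ cong (λ z → + z ℤ.+ + 1) i+1≡n ⟩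
    + n ℤ.+ + 1                       ≡⟨ ℤ.+-comm (+ n) (+ 1) ⟩
    + 1 ℤ.+ + n                       ≡⟨ cong₂ (λ y z → + suc y ℤ.+ z) (sym toℕ-first) (sym (ℤ.*-identityˡ (+ n))) ⟩
    val first ℤ.+ 1ℤ ℤ.* + n          ∎)
    where open ≡-Reasoning

-- Sorting

Linked-tabulate : {R : Rel A ℓ₁} (f : Fin n → A) →
                  (∀ i j → toℕ j ≡ suc (toℕ i) → R (f i) (f j)) → Linked R (List.tabulate f)
Linked-tabulate {n = 0}           f step = []
Linked-tabulate {n = 1}           f step = [-]
Linked-tabulate {n = suc (suc n)} f step =
  step zero (suc zero) refl ∷ Linked-tabulate (f ∘ suc) (λ i j eq → step (suc i) (suc j) (cong suc eq))

-- Both lists are duplicate-free and have the same members, which forces equal multiplicities.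
tabulate-↭ : (P : Permutation′ n) → allFin n ↭ List.tabulate (P ⟨$⟩ʳ_)
tabulate-↭ {n} P = ∼bag⇒↭ (unique∧set⇒bag
  (allFin⁺ n)
  (tabulate⁺ (λ {i} {j} eq → trans (sym (inverseˡ P)) (trans (cong (P ⟨$⟩ˡ_) eq) (inverseˡ P))))
  (λ {p} → mk⇔
    (λ _ → subst (_∈ List.tabulate (P ⟨$⟩ʳ_)) (inverseʳ P) (∈-tabulate⁺ (P ⟨$⟩ˡ p)))
    (λ _ → ∈-allFin p)))

module _ (O : DecTotalOrder ℓ₁ ℓ₂ ℓ₃) where
  open DecTotalOrder O using (totalOrder; module Eq) renaming (_≈_ to _≈ₒ_)
  open Sort O using (sort; sort-↭; sort-↗)

  -- Two sorted rearrangements of one list agree up to the equivalence of the order, so exhibiting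
  -- one replaces any analysis of the sorting algorithm.
  sort-unique : ∀ {xs ys} → xs ↭ ys → Sorted.Sorted totalOrder ys → Pointwise _≈ₒ_ (sort xs) ys
  sort-unique {xs} xs↭ys ys↗ = ↗↭↗⇒≋ totalOrder (sort-↗ xs) ys↗
    (Homogeneous.map Eq.reflexive (↭⇒↭ₛ (↭-trans (sort-↭ xs) xs↭ys)))

open DecTotalOrder lexOrder using () renaming (_≤_ to _≼_)

-- Suffixes and rotations

module _ (T : String n) .{{_ : NonZero n}} where

  -- Cyclic reading, resuming at position 1 after position n. Suffixes and rotations are both walks,
  -- of different lengths, so letter comparisons along walks serve both.
  walk : Fin n → ℕ → List Letter
  walk p zero    = []
  walk p (suc m) = lookup T p ∷ walk (p ⊕ + 1) m

  drop-toList : (p : Fin n) → drop (toℕ p) (toList T) ≡ lookup T p ∷ drop (suc (toℕ p)) (toList T)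
  drop-toList p = go T p
    where
    go : ∀ {n} (T : String n) (p : Fin n) → drop (toℕ p) (toList T) ≡ lookup T p ∷ drop (suc (toℕ p)) (toList T)
    go (x ∷ T) zero    = refl
    go (x ∷ T) (suc p) = go T p

  drop-all : ∀ m → m ≡ n → drop m (toList T) ≡ []
  drop-all _ refl = go T
    where
    go : ∀ {n} (T : String n) → drop n (toList T) ≡ []
    go []      = refl
    go (x ∷ T) = go T

  walk-take : ∀ m p → toℕ p + m ≤ n → walk p m ≡ take m (drop (toℕ p) (toList T))
  walk-take zero          p _   = refl
  -- Split off because `p` may be the last position here, and then `p ⊕ + 1` wraps instead of having
  -- index `suc (toℕ p)`.
  walk-take (suc zero)    p _   = sym (cong (take 1) (drop-toList p))
  walk-take (suc (suc m)) p p+m≤n = begin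
    lookup T p ∷ walk (p ⊕ + 1) (suc m)                                  ≡⟨ cong (lookup T p ∷_) (walk-take (suc m) (p ⊕ + 1) p+1+m≤n) ⟩
    lookup T p ∷ take (suc m) (drop (toℕ (p ⊕ + 1)) (toList T))          ≡⟨ cong (λ z → lookup T p ∷ take (suc m) (drop z (toList T))) σp ⟩
    lookup T p ∷ take (suc m) (drop (suc (toℕ p)) (toList T))            ≡⟨ cong (take (suc (suc m))) (drop-toList p) ⟨
    take (suc (suc m)) (drop (toℕ p) (toList T))                         ∎
    where
    open ≡-Reasoning
    p+1+m≤n′ : suc (toℕ p) + suc m ≤ n
    p+1+m≤n′ = subst (_≤ n) (ℕ.+-suc (toℕ p) (suc m)) p+m≤n
    σp : toℕ (p ⊕ + 1) ≡ suc (toℕ p)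
    σp = toℕ-⊕1 p (ℕ.<-≤-trans (ℕ.m<m+n (suc (toℕ p)) ℕ.z<s) p+1+m≤n′)
    p+1+m≤n : toℕ (p ⊕ + 1) + suc m ≤ n
    p+1+m≤n = subst (λ z → z + suc m ≤ n) (sym σp) p+1+m≤n′

  -- The first `suc m` letters reach exactly the end of the string. Taking r = 0 gives suffixes, r =
  -- `toℕ p` gives rotations.
  walk-wrap : ∀ m r p → toℕ p + suc m ≡ n → walk p (suc m + r) ≡ suffix T p ++ walk first r
  walk-wrap zero r p p+1≡n rewrite drop-toList p = cong (lookup T p ∷_) (begin
    walk (p ⊕ + 1) r                                   ≡⟨ cong (λ z → walk z r) (⊕1-wraps p 1+p≡n) ⟩
    walk first r                                       ≡⟨ cong (_++ walk first r) (drop-all (suc (toℕ p)) 1+p≡n) ⟨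
    drop (suc (toℕ p)) (toList T) ++ walk first r      ∎)
    where
    open ≡-Reasoning
    1+p≡n : suc (toℕ p) ≡ n
    1+p≡n = trans (ℕ.+-comm 1 (toℕ p)) p+1≡n
  walk-wrap (suc m) r p p+m≡n rewrite drop-toList p = cong (lookup T p ∷_) (begin
    walk (p ⊕ + 1) (suc m + r)                                  ≡⟨ walk-wrap m r (p ⊕ + 1) (trans (cong (_+ suc m) σp) 1+p+m≡n) ⟩
    suffix T (p ⊕ + 1) ++ walk first r                          ≡⟨ cong (λ z → drop z (toList T) ++ walk first r) σp ⟩
    drop (suc (toℕ p)) (toList T) ++ walk first r               ∎)
    where
    open ≡-Reasoning
    1+p+m≡n : suc (toℕ p) + suc m ≡ n
    1+p+m≡n = trans (sym (ℕ.+-suc (toℕ p) (suc m))) p+m≡n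
    σp : toℕ (p ⊕ + 1) ≡ suc (toℕ p)
    σp = toℕ-⊕1 p (subst (suc (toℕ p) <_) 1+p+m≡n (ℕ.m<m+n (suc (toℕ p)) ℕ.z<s))

  remaining : (p : Fin n) → ∃[ m ] toℕ p + suc m ≡ n
  remaining p with ℕ.m≤n⇒∃[o]m+o≡n (Fin.toℕ<n p)
  ... | m , eq = m , trans (ℕ.+-suc (toℕ p) m) eq

  suffix-walk : ∀ m p → toℕ p + suc m ≡ n → suffix T p ≡ walk p (suc m)
  suffix-walk m p p+m≡n = begin
    suffix T p                   ≡⟨ ++-identityʳ _ ⟨
    suffix T p ++ walk first 0   ≡⟨ walk-wrap m 0 p p+m≡n ⟨
    walk p (suc m + 0)           ≡⟨ cong (walk p) (ℕ.+-identityʳ (suc m)) ⟩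
    walk p (suc m)               ∎
    where open ≡-Reasoning

  rotation-walk : ∀ p → rotation T p ≡ walk p n
  rotation-walk p with remaining p
  ... | m , p+m≡n = begin
    -- As `first` has index 0, the inserted `drop` changes nothing and puts the prefix in the form
    -- that `walk-take` produces.
    suffix T p ++ take (toℕ p) (toList T)                        ≡⟨ cong (λ z → suffix T p ++ take (toℕ p) (drop z (toList T))) toℕ-first ⟨
    suffix T p ++ take (toℕ p) (drop (toℕ (first {n})) (toList T))   ≡⟨ cong (suffix T p ++_) (walk-take (toℕ p) first first+p≤n) ⟨
    suffix T p ++ walk first (toℕ p)                             ≡⟨ walk-wrap m (toℕ p) p p+m≡n ⟨
    walk p (suc m + toℕ p)                                       ≡⟨ cong (walk p) (trans (ℕ.+-comm (suc m) (toℕ p)) p+m≡n) ⟩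
    walk p n                                                     ∎
    where
    open ≡-Reasoning
    first+p≤n : toℕ (first {n}) + toℕ p ≤ n
    first+p≤n = subst (λ z → z + toℕ p ≤ n) (sym toℕ-first) (ℕ.<⇒≤ (Fin.toℕ<n p))

  last-walk : ∀ m p → last (walk p (suc m)) ≡ just (lookup T (p ⊕ + m))
  last-walk zero    p = cong (just ∘ lookup T) (sym (⊕-identityʳ p))
  last-walk (suc m) p = trans (last-walk m (p ⊕ + 1)) (cong (just ∘ lookup T) (⊕-assoc p (+ 1) (+ m)))

  -- The last letter of a rotation lies n - 1 steps ahead of its start, which is cyclically one step
  -- back: the letter that `saBWT` reads.
  last-rotation : ∀ p → last (rotation T p) ≡ just (lookup T (p ⊕ ℤ.- + 1))
  last-rotation p with ℕ.m≤n⇒∃[o]m+o≡n (ℕ.>-nonZero⁻¹ n)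
  ... | m , 1+m≡n = begin
    last (rotation T p)                   ≡⟨ cong last (rotation-walk p) ⟩
    last (walk p n)                       ≡⟨ cong (last ∘ walk p) 1+m≡n ⟨
    last (walk p (suc m))                 ≡⟨ last-walk m p ⟩
    -- Since `suc m` is n, the offset m is -1 + n, a form from which `⊕-periodic` removes n.
    just (lookup T (p ⊕ + m))             ≡⟨ cong (λ z → just (lookup T (p ⊕ (ℤ.- + 1 ℤ.+ + z)))) 1+m≡n ⟩
    just (lookup T (p ⊕ (ℤ.- + 1 ℤ.+ + n)))   ≡⟨ cong (just ∘ lookup T) (⊕-periodic p (ℤ.- + 1)) ⟩
    just (lookup T (p ⊕ ℤ.- + 1))         ∎
    where open ≡-Reasoning

  -- The lengths alone tell suffixes apart. This turns agreement of sorted lists up to equal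
  -- suffixes into equality of positions.
  suffix-injective : ∀ {p q} → Pointwise _≡_ (suffix T p) (suffix T q) → p ≡ q
  suffix-injective {p} {q} eq = Fin.toℕ-injective (ℕ.∸-cancelˡ-≡ (ℕ.<⇒≤ (Fin.toℕ<n p)) (ℕ.<⇒≤ (Fin.toℕ<n q)) (begin
    n ∸ toℕ p                        ≡⟨ len p ⟨
    length (suffix T p)              ≡⟨ Pointwise-length eq ⟩
    length (suffix T q)              ≡⟨ len q ⟩
    n ∸ toℕ q                        ∎))
    where
    open ≡-Reasoning
    len : ∀ p → length (suffix T p) ≡ n ∸ toℕ p
    len p = trans (length-drop (toℕ p) (toList T)) (cong (_∸ toℕ p) (length-toList T))

  module _ (P : Permutation′ n) where

    private
      entries : List (Fin n)
      entries = List.tabulate (P ⟨$⟩ʳ_)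

    -- Ties between suffixes are impossible, so a sorted listing of the positions must be the suffix
    -- array itself.
    saBWT-sorted : Linked (λ p q → suffix T p ≼ suffix T q) entries →
                   saBWT T ≡ List.map (λ p → lookup T (p ⊕ ℤ.- + 1)) entries
    saBWT-sorted entries↗ = cong (List.map _) (Pointwise-≡⇒≡ (Pointwise.map suffix-injective
      (sort-unique (On.decTotalOrder lexOrder (suffix T)) (tabulate-↭ P) entries↗)))

    -- Distinct positions may have equal rotations, but here strings rather than positions are
    -- sorted, so ties are harmless: the sorted list of strings is unique.
    matrixBWT-sorted : Linked (λ p q → rotation T p ≼ rotation T q) entries →
                       matrixBWT T ≡ List.map (λ p → lookup T (p ⊕ ℤ.- + 1)) entries
    matrixBWT-sorted entries↗ = begin
      matrixBWT T                                                   ≡⟨ cong (mapMaybe last) sorted ⟩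
      mapMaybe last (List.map (rotation T) entries)                 ≡⟨ mapMaybe-map last (rotation T) entries ⟩
      mapMaybe (last ∘ rotation T) entries                          ≡⟨ mapMaybe-cong last-rotation entries ⟩
      mapMaybe (just ∘ previous) entries                            ≡⟨ mapMaybe-map just previous entries ⟨
      mapMaybe just (List.map previous entries)                     ≡⟨ mapMaybe-just _ ⟩
      List.map previous entries                                     ∎
      where
      open ≡-Reasoning
      previous : Fin n → Letter
      previous p = lookup T (p ⊕ ℤ.- + 1)
      sorted : Sort.sort lexOrder (List.map (rotation T) (allFin n)) ≡ List.map (rotation T) entries
      -- The inner conversion concerns the letters of one rotation, the outer one the list of
      -- rotations.
      sorted = Pointwise-≡⇒≡ (Pointwise.map Pointwise-≡⇒≡
        (sort-unique lexOrder (map⁺ (rotation T) (tabulate-↭ P)) (Linked.map⁺ entries↗)))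

-- The letters along P

module _ {lo hi : ℕ} (lo≤hi : lo ≤ hi) where

  private
    -- The case distinction of `blockLetter`, with the smaller and the larger cut index abstracted
    -- to `lo` and `hi`.
    letter : ℕ → Letter
    letter i = if i ≤ᵇ lo then a else if i ≤ᵇ hi then b else c

  letter-mono : ∀ {i j} → i ≤ j → letter i Fin.≤ letter j
  letter-mono {i} {j} i≤j
    with i ≤ᵇ lo | ℕ.≤ᵇ-reflects-≤ i lo | j ≤ᵇ lo | ℕ.≤ᵇ-reflects-≤ j lo
  ... | true  | _         | _     | _         = z≤n
  ... | false | ofⁿ i≰lo  | true  | ofʸ j≤lo  = contradiction (ℕ.≤-trans i≤j j≤lo) i≰lo
  ... | false | _         | false | _
    with i ≤ᵇ hi | ℕ.≤ᵇ-reflects-≤ i hi | j ≤ᵇ hi | ℕ.≤ᵇ-reflects-≤ j hi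
  ...   | true  | _        | true  | _        = s≤s z≤n
  ...   | true  | _        | false | _        = s≤s z≤n
  ...   | false | ofⁿ i≰hi | true  | ofʸ j≤hi = contradiction (ℕ.≤-trans i≤j j≤hi) i≰hi
  ...   | false | _        | false | _        = s≤s (s≤s z≤n)

  letter-lo : ∀ {j} → lo < j → letter lo Fin.< letter j
  letter-lo {j} lo<j with lo ≤ᵇ lo | ℕ.≤ᵇ-reflects-≤ lo lo | j ≤ᵇ lo | ℕ.≤ᵇ-reflects-≤ j lo
  ... | false | ofⁿ lo≰lo | _     | _        = contradiction ℕ.≤-refl lo≰lo
  ... | true  | _         | true  | ofʸ j≤lo = contradiction j≤lo (ℕ.<⇒≱ lo<j)
  ... | true  | _         | false | _ with j ≤ᵇ hi
  ...   | true  = s≤s z≤n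
  ...   | false = s≤s z≤n

  letter-hi : ∀ {j} → hi < j → letter hi Fin.< letter j
  letter-hi {j} hi<j
    with j ≤ᵇ lo | ℕ.≤ᵇ-reflects-≤ j lo | j ≤ᵇ hi | ℕ.≤ᵇ-reflects-≤ j hi
  ... | true  | ofʸ j≤lo | _     | _        = contradiction (ℕ.≤-trans j≤lo lo≤hi) (ℕ.<⇒≱ hi<j)
  ... | false | _        | true  | ofʸ j≤hi = contradiction j≤hi (ℕ.<⇒≱ hi<j)
  ... | false | _        | false | _
    with hi ≤ᵇ lo | hi ≤ᵇ hi | ℕ.≤ᵇ-reflects-≤ hi hi
  -- Here the cuts coincide and the letter at `hi` is a instead of b; c exceeds both.
  ...   | true  | _     | _         = s≤s z≤n
  ...   | false | true  | _         = s≤s (s≤s z≤n)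
  ...   | false | false | ofⁿ hi≰hi = contradiction ℕ.≤-refl hi≰hi

module _ .{{_ : NonZero n}} (P : Permutation′ n) (k : ℕ) where

  private
    x y : ℕ
    x = toℕ (cut₁ P k)
    y = toℕ (cut₂ P k)

    x⊓y≤x⊔y : x ⊓ y ≤ x ⊔ y
    x⊓y≤x⊔y = ℕ.≤-trans (ℕ.m⊓n≤m x y) (ℕ.m≤m⊔n x y)

    letter : ℕ → Letter
    letter i = if i ≤ᵇ x ⊓ y then a else if i ≤ᵇ x ⊔ y then b else c

  blockLetter-mono : ∀ {i j} → toℕ i ≤ toℕ j → blockLetter P k i Fin.≤ blockLetter P k j
  blockLetter-mono = letter-mono x⊓y≤x⊔y

  -- Each cut index is the minimum or the maximum of the two, hence a threshold past which the
  -- letter grows.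
  blockLetter-cut : ∀ {i j} → i ≡ cut₁ P k ⊎ i ≡ cut₂ P k → toℕ i < toℕ j →
                    blockLetter P k i Fin.< blockLetter P k j
  blockLetter-cut {i} {j} i-cut i<j with extremal i-cut
    where
    extremal : i ≡ cut₁ P k ⊎ i ≡ cut₂ P k → x ⊓ y ≡ toℕ i ⊎ x ⊔ y ≡ toℕ i
    extremal (inj₁ refl) with ℕ.≤-total x y
    ... | inj₁ x≤y = inj₁ (ℕ.m≤n⇒m⊓n≡m x≤y)
    ... | inj₂ y≤x = inj₂ (ℕ.m≥n⇒m⊔n≡m y≤x)
    extremal (inj₂ refl) with ℕ.≤-total x y
    ... | inj₁ x≤y = inj₂ (ℕ.m≤n⇒m⊔n≡n x≤y)
    ... | inj₂ y≤x = inj₁ (ℕ.m≥n⇒m⊓n≡n y≤x)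
  ... | inj₁ lo≡i = subst (λ z → letter z Fin.< letter (toℕ j)) lo≡i
                      (letter-lo x⊓y≤x⊔y (subst (_< toℕ j) (sym lo≡i) i<j))
  ... | inj₂ hi≡i = subst (λ z → letter z Fin.< letter (toℕ j)) hi≡i
                      (letter-hi x⊓y≤x⊔y (subst (_< toℕ j) (sym hi≡i) i<j))

-- Comparing the strings read from `p` and from `κ p`

module _ .{{_ : NonZero n}} (P : Permutation′ n) (k : ℕ) (ap : ArithmeticallyProgressed P k) where

  open ArithmeticallyProgressed ap

  private
    T : String n
    T = ternaryString P k

    index : Fin n → Fin n
    index p = P ⟨$⟩ˡ p

    σ κ : Fin n → Fin n
    σ p = p ⊕ + 1
    κ p = p ⊕ + k

    NotLast : Fin n → Set
    NotLast p = suc (toℕ (index p)) < n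

  index-κ : ∀ p → NotLast p → toℕ (index (κ p)) ≡ suc (toℕ (index p))
  index-κ p p-notLast = begin
    toℕ (index (p ⊕ + k))                     ≡⟨ cong (λ q → toℕ (index (q ⊕ + k))) (inverseʳ P) ⟨
    toℕ (index ((P ⟨$⟩ʳ index p) ⊕ + k))      ≡⟨ cong (toℕ ∘ index) (step (index p) j (Fin.toℕ-fromℕ< p-notLast)) ⟨
    toℕ (index (P ⟨$⟩ʳ j))                    ≡⟨ cong toℕ (inverseˡ P) ⟩
    toℕ j                                     ≡⟨ Fin.toℕ-fromℕ< p-notLast ⟩
    suc (toℕ (index p))                       ∎
    where
    open ≡-Reasoning
    j = fromℕ< p-notLast

  -- The sequence P is cyclic: a predecessor of κ e in P would be e itself.
  κ-last : ∀ e → suc (toℕ (index e)) ≡ n → κ e ≡ p₁ P k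
  κ-last e e-last with toℕ (index (κ e)) in eq
  ... | zero  = begin
    κ e                        ≡⟨ inverseʳ P ⟨
    P ⟨$⟩ʳ index (κ e)         ≡⟨ cong (P ⟨$⟩ʳ_) (Fin.toℕ-injective (trans eq (sym toℕ-first))) ⟩
    P ⟨$⟩ʳ first               ∎
    where open ≡-Reasoning
  ... | suc j = contradiction (subst (_< n) (trans eq sj≡n) (Fin.toℕ<n (index (κ e)))) (ℕ.n≮n n)
    where
    open ≡-Reasoning
    j<n : j < n
    j<n = ℕ.<-trans ℕ.≤-refl (subst (_< n) eq (Fin.toℕ<n (index (κ e))))
    i = fromℕ< j<n
    Pi≡e : P ⟨$⟩ʳ i ≡ e
    Pi≡e = ⊕-cancelʳ (+ k) (begin
      (P ⟨$⟩ʳ i) ⊕ + k       ≡⟨ step i (index (κ e)) (trans eq (cong suc (sym (Fin.toℕ-fromℕ< j<n)))) ⟨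
      P ⟨$⟩ʳ index (κ e)     ≡⟨ inverseʳ P ⟩
      e ⊕ + k                ∎)
    sj≡n : suc j ≡ n
    sj≡n = begin
      suc j                        ≡⟨ cong suc (Fin.toℕ-fromℕ< j<n) ⟨
      suc (toℕ i)                  ≡⟨ cong (suc ∘ toℕ) (inverseˡ P) ⟨
      suc (toℕ (index (P ⟨$⟩ʳ i)))  ≡⟨ cong (suc ∘ toℕ ∘ index) Pi≡e ⟩
      suc (toℕ (index e))          ≡⟨ e-last ⟩
      n                            ∎

  -- By `κ-last` the last entry is p₁ - k, so its cyclic predecessor as a number is p₁ - k - 1, the
  -- entry of the second cut.
  before-last⇒cut₂ : ∀ p → suc (toℕ (index (σ p))) ≡ n → index p ≡ cut₂ P k
  before-last⇒cut₂ p σp-last = cong index (begin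
    p                                             ≡⟨ ⊕-inverseʳ p (+ 1) ⟨
    p ⊕ + 1 ⊕ ℤ.- + 1                             ≡⟨ cong (_⊕ ℤ.- + 1) (⊕-inverseʳ (p ⊕ + 1) (+ k)) ⟨
    p ⊕ + 1 ⊕ + k ⊕ ℤ.- + k ⊕ ℤ.- + 1             ≡⟨ cong (λ q → q ⊕ ℤ.- + k ⊕ ℤ.- + 1) (κ-last (σ p) σp-last) ⟩
    p₁ P k ⊕ ℤ.- + k ⊕ ℤ.- + 1                    ≡⟨ mod₁-⊕ (val (p₁ P k) ℤ.- + k) (ℤ.- + 1) ⟩
    val (p₁ P k) ℤ.- + k ℤ.- + 1 mod₁ n           ∎)
    where open ≡-Reasoning

  -- Here `suc (toℕ (κ p))` is the one-based value of `κ p`, so p + k is n modulo n, and p is the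
  -- entry n - k of the first cut.
  κ-top⇒cut₁ : ∀ p → suc (toℕ (κ p)) ≡ n → index p ≡ cut₁ P k
  κ-top⇒cut₁ p κp-top = cong index (begin
    p                               ≡⟨ ⊕-inverseʳ p (+ k) ⟨
    κ p ⊕ ℤ.- + k                   ≡⟨ cong (λ m → + m ℤ.+ ℤ.- + k mod₁ n) κp-top ⟩
    + n ℤ.+ ℤ.- + k mod₁ n          ∎)
    where open ≡-Reasoning

  private
    index-increases : ∀ p → NotLast p → toℕ (index p) < toℕ (index (κ p))
    index-increases p p-notLast = ℕ.≤-reflexive (sym (index-κ p p-notLast))

    lookup-T : ∀ p → lookup T p ≡ blockLetter P k (index p)
    lookup-T = lookup∘tabulate (blockLetter P k ∘ index)

  lookup-κ-≤ : ∀ p → NotLast p → lookup T p Fin.≤ lookup T (κ p)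
  lookup-κ-≤ p p-notLast = subst₂ Fin._≤_ (sym (lookup-T p)) (sym (lookup-T (κ p)))
    (blockLetter-mono P k (ℕ.<⇒≤ (index-increases p p-notLast)))

  lookup-κ-< : ∀ p → NotLast p → index p ≡ cut₁ P k ⊎ index p ≡ cut₂ P k →
               lookup T p Fin.< lookup T (κ p)
  lookup-κ-< p p-notLast p-cut = subst₂ Fin._<_ (sym (lookup-T p)) (sym (lookup-T (κ p)))
    (blockLetter-cut P k p-cut (index-increases p p-notLast))

  -- `strict` splits the strict order into `≤` and `≢`, as the lexicographic order expects. `equal`
  -- records what lets the comparison go on: `σ p` is not the last entry of P, and `κ p` is not
  -- position n.
  data Step (p : Fin n) : Set where
    strict : lookup T p Fin.≤ lookup T (κ p) → lookup T p ≢ lookup T (κ p) → Step p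
    equal  : lookup T p ≡ lookup T (κ p) → NotLast (σ p) → suc (toℕ (κ p)) < n → Step p

  -- Letters grow strictly across either cut, so a tie places `p` at neither; each obstacle to going
  -- on would place it at one.
  compare-step : ∀ p → NotLast p → Step p
  compare-step p p-notLast with lookup T p Fin.≟ lookup T (κ p)
  ... | no  Tp≢Tκp = strict (lookup-κ-≤ p p-notLast) Tp≢Tκp
  ... | yes Tp≡Tκp = equal Tp≡Tκp
    (ℕ.≤∧≢⇒< (Fin.toℕ<n (index (σ p))) (not-cut ∘ inj₂ ∘ before-last⇒cut₂ p))
    (ℕ.≤∧≢⇒< (Fin.toℕ<n (κ p)) (not-cut ∘ inj₁ ∘ κ-top⇒cut₁ p))
    where
    not-cut : ¬ (index p ≡ cut₁ P k ⊎ index p ≡ cut₂ P k)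
    not-cut p-cut = Fin.<⇒≢ (lookup-κ-< p p-notLast p-cut) Tp≡Tκp

  -- Walks of equal length either meet a strict step or run out together; each tie hands `NotLast`
  -- on to the next position.
  walk-κ-≼ : ∀ m p → NotLast p → walk T p m ≼ walk T (κ p) m
  walk-κ-≼ zero    p _         = base tt
  walk-κ-≼ (suc m) p p-notLast with compare-step p p-notLast
  ... | strict ≤κ ≢κ      = this (≤κ , ≢κ)
  ... | equal eq σp-notLast _ = next eq
    -- The second walk continues at `σ (κ p)`, while the induction speaks of `κ (σ p)`; cyclic
    -- shifts commute.
    (subst (λ q → walk T (σ p) m ≼ walk T q m) (⊕-comm p (+ 1) (+ k)) (walk-κ-≼ m (σ p) σp-notLast))

  -- The right walk is the whole suffix at `κ p` and must not end first. It does not, because a tie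
  -- excludes that `κ p` is position n. If the left walk ends first, it is a proper prefix.
  walk-suffix-κ-≼ : ∀ m m′ p → NotLast p → toℕ (κ p) + suc m′ ≡ n → walk T p m ≼ walk T (κ p) (suc m′)
  walk-suffix-κ-≼ zero    m′ p _ _ = halt
  walk-suffix-κ-≼ (suc m) m′ p p-notLast κp+m≡n with compare-step p p-notLast
  ... | strict ≤κ ≢κ = this (≤κ , ≢κ)
  -- A single letter left on the right puts `κ p` at position n, against the tie.
  walk-suffix-κ-≼ (suc m) zero p _ κp+1≡n | equal _ _ κp+1<n =
    contradiction (trans (ℕ.+-comm 1 (toℕ (κ p))) κp+1≡n) (ℕ.<⇒≢ κp+1<n)
  walk-suffix-κ-≼ (suc m) (suc m′) p _ κp+m≡n | equal eq σp-notLast κp+1<n = next eq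
    (subst (λ q → walk T (σ p) m ≼ walk T q (suc m′)) (⊕-comm p (+ 1) (+ k))
      (walk-suffix-κ-≼ m m′ (σ p) σp-notLast (begin
        toℕ (κ (σ p)) + suc m′          ≡⟨ cong (λ q → toℕ q + suc m′) (⊕-comm p (+ 1) (+ k)) ⟩
        toℕ (σ (κ p)) + suc m′          ≡⟨ cong (_+ suc m′) (toℕ-⊕1 (κ p) κp+1<n) ⟩
        suc (toℕ (κ p)) + suc m′        ≡⟨ ℕ.+-suc (toℕ (κ p)) (suc m′) ⟨
        toℕ (κ p) + suc (suc m′)        ≡⟨ κp+m≡n ⟩
        n                               ∎)))
    where open ≡-Reasoning

  rotation-κ-≼ : ∀ p → NotLast p → rotation T p ≼ rotation T (κ p)
  rotation-κ-≼ p p-notLast = subst₂ _≼_ (sym (rotation-walk T p)) (sym (rotation-walk T (κ p)))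
    (walk-κ-≼ n p p-notLast)

  suffix-κ-≼ : ∀ p → NotLast p → suffix T p ≼ suffix T (κ p)
  suffix-κ-≼ p p-notLast with remaining T p | remaining T (κ p)
  ... | m , p+m≡n | m′ , κp+m′≡n = subst₂ _≼_
    (sym (suffix-walk T m p p+m≡n)) (sym (suffix-walk T m′ (κ p) κp+m′≡n))
    (walk-suffix-κ-≼ (suc m) m′ p p-notLast κp+m′≡n)

  -- By `step`, neighbours in P have the form `p`, `κ p`. The relation is abstract so as to serve
  -- suffixes and rotations alike.
  entries-linked : {R : Rel (Fin n) ℓ} → (∀ p → NotLast p → R p (κ p)) → Linked R (List.tabulate (P ⟨$⟩ʳ_))
  entries-linked {R = R} R-κ = Linked-tabulate (P ⟨$⟩ʳ_) λ i j j≡i+1 →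
    subst (R (P ⟨$⟩ʳ i)) (sym (step i j j≡i+1))
      -- The entry at index i is not the last one, because the next index j is still below n.
      (R-κ (P ⟨$⟩ʳ i) (subst (_< n) (trans j≡i+1 (cong (suc ∘ toℕ) (sym (inverseˡ P)))) (Fin.toℕ<n j)))

theorem4 : (n : ℕ) → .{{_ : NonZero n}} → 2 ≤ n →
    (P : Permutation′ n) → ¬ (P ≈ reverse) →
    (k : ℕ) → ArithmeticallyProgressed P k →
    matrixBWT (ternaryString P k) ≡ saBWT (ternaryString P k)
theorem4 n _ P _ k ap = trans
  (matrixBWT-sorted (ternaryString P k) P (entries-linked P k ap (rotation-κ-≼ P k ap)))
  (sym (saBWT-sorted (ternaryString P k) P (entries-linked P k ap (suffix-κ-≼ P k ap))))
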